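{- For every integer $n$ there exists an undirected simple graph $G$ such that $\chi_{(0,2)}(G)-\chi_{(1,0)}(G)=n$.
   Context: For integers $m,n\ge0$, an $(m,n)$-colored mixed graph has arcs colored with $m$ colors and edges colored with $n$ colors, with simple underlying undirected graph. A homomorphism $f:G\to H$ maps vertices to vertices so that every arc (resp. edge) $uv$ of color $c$ is sent to an arc (resp. edge) $f(u)f(v)$ of color $c$ (arcs keep direction). For an $(m,n)$-colored mixed graph $G$, $\chi_{(m,n)}(G)$ is the minimum order of an $(m,n)$-colored mixed graph $H$ with a homomorphism $G\to H$. For an undirected simple graph $G$, $\chi_{(m,n)}(G)$ is the maximum of $\chi_{(m,n)}$ over all $(m,n)$-colored mixed graphs with underlying graph $G$. Thus $\chi_{(1,0)}(G)$ is the oriented chromatic number (maximum over orientations of $G$) and $\chi_{(0,2)}(G)$ is the maximum over all 2-edge-colorings of $G$. -}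

module Defs where

open import Data.Nat using (ℕ; _≤_)
open import Data.Fin using (Fin)
open import Data.Bool using (Bool; true; false)
open import Data.Product using (Σ; _×_; ∃; ∃-syntax)
open import Relation.Binary.PropositionalEquality using (_≡_)

record SimpleGraph (v : ℕ) : Set where
  field
    adj    : Fin v → Fin v → Bool
    sym    : ∀ x y → adj x y ≡ adj y x
    irrefl : ∀ x → adj x x ≡ false
open SimpleGraph public

-- What sits on the ordered pair (x , y) of an (m,n)-colored mixed graph:
-- nothing, an arc x→y of color c, an arc y→x of color c, or an edge of color c.
data Mark (m n : ℕ) : Set where
  none : Mark m n
  out  : Fin m → Mark m n
  inc  : Fin m → Mark m n
  edge : Fin n → Mark m n

flip : ∀ {m n} → Mark m n → Mark m n
flip none     = none
flip (out c)  = inc c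
flip (inc c)  = out c
flip (edge c) = edge c

present : ∀ {m n} → Mark m n → Bool
present none = false
present _    = true

record MixedGraph (m n v : ℕ) : Set where
  field
    mark      : Fin v → Fin v → Mark m n
    mark-flip : ∀ x y → mark y x ≡ flip (mark x y)
    mark-loop : ∀ x → mark x x ≡ none
open MixedGraph public

IsHom : ∀ {m n v w} → MixedGraph m n v → MixedGraph m n w → (Fin v → Fin w) → Set
IsHom G H f = ∀ x y → present (mark G x y) ≡ true → mark H (f x) (f y) ≡ mark G x y

Hom : ∀ {m n v w} → MixedGraph m n v → MixedGraph m n w → Set
Hom G H = Σ (Fin _ → Fin _) (IsHom G H)

IsChiMixed : ∀ {m n v} → MixedGraph m n v → ℕ → Set
IsChiMixed {m} {n} G k =
  (Σ (MixedGraph m n k) λ H → Hom G H) ×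
  (∀ j (H : MixedGraph m n j) → Hom G H → k ≤ j)

HasUnderlying : ∀ {m n v} → MixedGraph m n v → SimpleGraph v → Set
HasUnderlying M G = ∀ x y → adj G x y ≡ present (mark M x y)

IsChi : (m n : ℕ) → ∀ {v} → SimpleGraph v → ℕ → Set
IsChi m n {v} G k =
  (∀ (M : MixedGraph m n v) → HasUnderlying M G → ∃[ j ] (IsChiMixed M j × j ≤ k)) ×
  (Σ (MixedGraph m n v) λ M → HasUnderlying M G × IsChiMixed M k)

{-# OPTIONS --safe #-}
-- The difference χ₀₂ - χ₁₀ is interpolated. Adding a vertex whose neighbourhood is a clique raises
-- each of the two chromatic numbers by at most one, so while a graph is built up by such vertices
-- the difference moves in steps of at most one and misses no value.
--
-- Start: many disjoint pentagons, where any two vertices of different pentagons are joined by a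
-- path through a private hub of degree two. Oriented, all pentagon vertices may need different
-- colours. In a 2-edge-coloured pentagon some vertex sees one colour twice, so its neighbours can
-- be identified, and logarithmically many colours suffice for all hubs: the difference is very
-- negative.
--
-- End: next to the start, a clique of t apexes joined to 2 · 2ᵗ disjoint edges, two for each
-- pattern of colours towards the apexes. Two edges of different colours need three vertices in
-- the target, whereas two arcs need only two: the difference is very positive.
module Submission where

open import Defs
open import Data.Nat using (ℕ; zero; suc; _+_; _*_; _^_; _≤_; z≤n; s≤s; ≤′-reflexive; ≤′-step)
import Data.Nat as ℕ
import Data.Nat.Properties as ℕ
open import Data.Nat.Tactic.RingSolver using (solve-∀)
open import Data.Integer using (ℤ; +_; -[1+_]; _-_; _⊖_)
import Data.Integer.Properties as ℤ
open import Data.Fin using (Fin; zero; suc; _↑ˡ_; _↑ʳ_; splitAt; combine; opposite;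
                            finToFun; funToFin)
import Data.Fin.Properties as Fin
open import Data.Fin.Properties using (+↔⊎; *↔×)
open import Data.Bool using (Bool; true; false; if_then_else_)
import Data.Bool.Properties as Bool
open import Data.Product using (Σ; _×_; _,_; proj₁; proj₂; ∃; ∃-syntax)
open import Data.Product.Properties using (≡-dec)
open import Data.Product.Function.NonDependent.Propositional using (_×-↔_)
open import Data.Sum using (_⊎_; inj₁; inj₂)
open import Data.Sum.Function.Propositional using (_⊎-↔_)
open import Data.Vec.Functional using (_∷_)
open import Function using (id; _∘_; _↔_; Inverse; Injective)
open import Function.Properties.Inverse using (↔-refl; ↔-trans)
open import Relation.Nullary using (¬_; Dec; yes; no; contradiction)
open import Relation.Nullary.Decidable
  using (map′; ¬?; _×-dec_; _→-dec_; _⊎-dec_; decidable-stable; from-yes)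
open import Relation.Unary using (Decidable)
open import Relation.Binary.Definitions using (DecidableEquality)
open import Relation.Binary.PropositionalEquality as ≡
  using (_≡_; _≢_; refl; cong; cong₂; subst; _≗_)

open Inverse using (to; from; strictlyInverseˡ; strictlyInverseʳ)

private variable
  m n m′ n′ v w k : ℕ
  A B C : Set

-- Marks and exhaustive search over mixed graphs.

_≟ᴹ_ : DecidableEquality (Mark m n)
none   ≟ᴹ none   = yes refl
out c  ≟ᴹ out d  = map′ (cong out) (λ { refl → refl }) (c Fin.≟ d)
inc c  ≟ᴹ inc d  = map′ (cong inc) (λ { refl → refl }) (c Fin.≟ d)
edge c ≟ᴹ edge d = map′ (cong edge) (λ { refl → refl }) (c Fin.≟ d)
none   ≟ᴹ out _  = no λ ()
none   ≟ᴹ inc _  = no λ ()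
none   ≟ᴹ edge _ = no λ ()
out _  ≟ᴹ none   = no λ ()
out _  ≟ᴹ inc _  = no λ ()
out _  ≟ᴹ edge _ = no λ ()
inc _  ≟ᴹ none   = no λ ()
inc _  ≟ᴹ out _  = no λ ()
inc _  ≟ᴹ edge _ = no λ ()
edge _ ≟ᴹ none   = no λ ()
edge _ ≟ᴹ out _  = no λ ()
edge _ ≟ᴹ inc _  = no λ ()

flip-involutive : (a : Mark m n) → flip (flip a) ≡ a
flip-involutive none     = refl
flip-involutive (out _)  = refl
flip-involutive (inc _)  = refl
flip-involutive (edge _) = refl

present-flip : (a : Mark m n) → present (flip a) ≡ present a
present-flip none     = refl
present-flip (out _)  = refl
present-flip (inc _)  = refl
present-flip (edge _) = refl

_≈_ : MixedGraph m n v → MixedGraph m n v → Set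
M ≈ N = ∀ x y → mark M x y ≡ mark N x y

empty : MixedGraph m n 0
empty = record { mark = λ () ; mark-flip = λ () ; mark-loop = λ () }

extend : MixedGraph m n v → (Fin v → Mark m n) → MixedGraph m n (suc v)
extend {m} {n} {v} M r = record { mark = mk ; mark-flip = mk-flip ; mark-loop = mk-loop }
  where
  mk : Fin (suc v) → Fin (suc v) → Mark m n
  mk zero    zero    = none
  mk zero    (suc y) = r y
  mk (suc x) zero    = flip (r x)
  mk (suc x) (suc y) = mark M x y

  mk-flip : ∀ x y → mk y x ≡ flip (mk x y)
  mk-flip zero    zero    = refl
  mk-flip zero    (suc y) = refl
  mk-flip (suc x) zero    = ≡.sym (flip-involutive (r x))
  mk-flip (suc x) (suc y) = mark-flip M x y

  mk-loop : ∀ x → mk x x ≡ none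
  mk-loop zero    = refl
  mk-loop (suc x) = mark-loop M x

extend-cong : {M N : MixedGraph m n v} {r s : Fin v → Mark m n} →
              M ≈ N → r ≗ s → extend M r ≈ extend N s
extend-cong M≈N r≗s zero    zero    = refl
extend-cong M≈N r≗s zero    (suc y) = r≗s y
extend-cong M≈N r≗s (suc x) zero    = cong flip (r≗s x)
extend-cong M≈N r≗s (suc x) (suc y) = M≈N x y

tail : MixedGraph m n (suc v) → MixedGraph m n v
tail M = record
  { mark      = λ x y → mark M (suc x) (suc y)
  ; mark-flip = λ x y → mark-flip M (suc x) (suc y)
  ; mark-loop = λ x → mark-loop M (suc x)
  }

extend-tail : (M : MixedGraph m n (suc v)) → M ≈ extend (tail M) (mark M zero ∘ suc)
extend-tail M zero    zero    = mark-loop M zero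
extend-tail M zero    (suc y) = refl
extend-tail M (suc x) zero    = mark-flip M zero (suc x)
extend-tail M (suc x) (suc y) = refl

any-mark? : {P : Mark m n → Set} → Decidable P → Dec (∃ P)
any-mark? P? = map′
  (λ { (inj₁ p) → none , p
     ; (inj₂ (inj₁ (c , p))) → out c , p
     ; (inj₂ (inj₂ (inj₁ (c , p)))) → inc c , p
     ; (inj₂ (inj₂ (inj₂ (c , p)))) → edge c , p })
  (λ { (none , p) → inj₁ p
     ; (out c , p) → inj₂ (inj₁ (c , p))
     ; (inc c , p) → inj₂ (inj₂ (inj₁ (c , p)))
     ; (edge c , p) → inj₂ (inj₂ (inj₂ (c , p))) })
  (P? none ⊎-dec Fin.any? (P? ∘ out) ⊎-dec Fin.any? (P? ∘ inc) ⊎-dec Fin.any? (P? ∘ edge))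

-- For want of function extensionality, only predicates that respect pointwise equality are
-- decided.
any-function? : {A : Set} → (∀ {Q : A → Set} → Decidable Q → Dec (∃ Q)) →
                {P : (Fin v → A) → Set} → (∀ {f g} → f ≗ g → P f → P g) →
                Decidable P → Dec (∃ P)
any-function? {zero} any-A? resp P? =
  map′ (λ p → _ , p) (λ { (f , p) → resp (λ ()) p }) (P? (λ ()))
any-function? {suc v} any-A? {P} resp P? = map′
  (λ { (a , f , p) → a ∷ f , p })
  (λ { (f , p) → f zero , f ∘ suc , resp (λ { zero → refl ; (suc i) → refl }) p })
  (any-A? λ a → any-function? any-A?
    (λ f≗g → resp λ { zero → refl ; (suc i) → f≗g i })
    (λ f → P? (a ∷ f)))

-- A mixed graph on `suc v` vertices is determined by the marks at its first vertex and the graph on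
-- the rest, so the search recurses on the rest and runs through all rows of marks inside.
any-mixed? : {P : MixedGraph m n v → Set} → (∀ {M N} → M ≈ N → P M → P N) →
             Decidable P → Dec (∃ P)
any-mixed? {v = zero} resp P? =
  map′ (λ p → _ , p) (λ { (M , p) → resp (λ ()) p }) (P? empty)
any-mixed? {v = suc v} resp P? = map′
  (λ { (M , r , p) → extend M r , p })
  (λ { (M , p) → tail M , mark M zero ∘ suc , resp (extend-tail M) p })
  (any-mixed?
    (λ { {M} {N} M≈N (r , p) → r , resp (extend-cong {M = M} {N} M≈N (λ _ → refl)) p })
    (λ M → any-function? any-mark?
      (λ r≗s → resp (extend-cong {M = M} {M} (λ _ _ → refl) r≗s))
      (λ r → P? (extend M r))))

-- Colourability and existence of the chromatic numbers.

Colourable : MixedGraph m n v → ℕ → Set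
Colourable {m} {n} M k = Σ (MixedGraph m n k) (Hom M)

Colourable-cong : {M N : MixedGraph m n v} {k : ℕ} → M ≈ N → Colourable M k → Colourable N k
Colourable-cong M≈N (H , f , hom) = H , f , λ x y p →
  ≡.trans (hom x y (≡.trans (cong present (M≈N x y)) p)) (M≈N x y)

isHom? : (M : MixedGraph m n v) (H : MixedGraph m n w) → Decidable (IsHom M H)
isHom? M H f = Fin.all? λ x → Fin.all? λ y →
  (present (mark M x y) Bool.≟ true) →-dec (mark H (f x) (f y) ≟ᴹ mark M x y)

colourable? : (M : MixedGraph m n v) → Decidable (Colourable M)
colourable? M k = any-mixed?
  (λ { H≈K (f , hom) → f , λ x y p → ≡.trans (≡.sym (H≈K (f x) (f y))) (hom x y p) })
  (λ H → any-function? Fin.any?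
    (λ f≗g hom x y p → ≡.trans (≡.sym (cong₂ (mark H) (f≗g x) (f≗g y))) (hom x y p))
    (isHom? M H))

Colourable-suc : {M : MixedGraph m n v} {k : ℕ} → Colourable M k → Colourable M (suc k)
Colourable-suc (H , f , hom) = extend H (λ _ → none) , suc ∘ f , hom

Colourable-mono : {M : MixedGraph m n v} {j k : ℕ} → j ≤ k → Colourable M j → Colourable M k
Colourable-mono {M = M} {j} j≤k c = go (ℕ.≤⇒≤′ j≤k)
  where
  go : ∀ {k} → j ℕ.≤′ k → Colourable M k
  go (≤′-reflexive refl) = c
  go (≤′-step p) = Colourable-suc {M = M} (go p)

-- `Bounded` and `Demands` split `IsChi` into an upper and a lower bound that can be proved
-- separately. Neither mentions the exact chromatic number of a single mixed graph.
Bounded : (m n : ℕ) → SimpleGraph v → ℕ → Set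
Bounded {v} m n G k = ∀ (M : MixedGraph m n v) → HasUnderlying M G → Colourable M k

Demands : (m n : ℕ) → SimpleGraph v → ℕ → Set
Demands {v} m n G k =
  Σ (MixedGraph m n v) λ M → HasUnderlying M G × (∀ j → Colourable M j → k ≤ j)

hasUnderlying? : (M : MixedGraph m n v) (G : SimpleGraph v) → Dec (HasUnderlying M G)
hasUnderlying? M G = Fin.all? λ x → Fin.all? λ y → adj G x y Bool.≟ present (mark M x y)

uncolourable? : (G : SimpleGraph v) (k : ℕ) →
  Dec (Σ (MixedGraph m n v) λ M → HasUnderlying M G × ¬ Colourable M k)
uncolourable? G k = any-mixed?
  (λ { {M} {N} M≈N (u , ¬c) →
       (λ x y → ≡.trans (u x y) (cong present (M≈N x y))) ,
       ¬c ∘ Colourable-cong {M = N} {M} (λ x y → ≡.sym (M≈N x y)) })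
  (λ M → hasUnderlying? M G ×-dec ¬? (colourable? M k))

bounded? : (G : SimpleGraph v) → Decidable (Bounded m n G)
bounded? G k = map′
  (λ ¬∃ M u → decidable-stable (colourable? M k) λ ¬c → ¬∃ (M , u , ¬c))
  (λ { b (M , u , ¬c) → ¬c (b M u) })
  (¬? (uncolourable? G k))

-- The search descends from a known witness. As `P` is upward closed, its first failure on the way
-- down rules out all smaller values.
least : {P : ℕ → Set} → Decidable P → (∀ {k} → P k → P (suc k)) →
        ∀ v → P v → ∃[ k ] (P k × (∀ j → P j → k ≤ j))
least P? up zero    p = zero , p , λ _ _ → z≤n
least {P} P? up (suc v) p with P? v
... | yes q = least P? up v q
... | no ¬q = suc v , p , λ j r → ℕ.≰⇒> λ j≤v → ¬q (climb (ℕ.≤⇒≤′ j≤v) r)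
  where
  climb : ∀ {i j} → i ℕ.≤′ j → P i → P j
  climb (≤′-reflexive refl) r = r
  climb (≤′-step i≤j) r = up (climb i≤j r)

delete : SimpleGraph (suc v) → SimpleGraph v
delete G = record
  { adj    = λ x y → adj G (suc x) (suc y)
  ; sym    = λ x y → SimpleGraph.sym G (suc x) (suc y)
  ; irrefl = λ x → irrefl G (suc x)
  }

module _ (e : Mark m n) (e-present : present e ≡ true) where

  -- One fixed present mark `e` ensures that every simple graph underlies some mixed graph, which
  -- would fail with no colours at all.
  row : SimpleGraph (suc v) → Fin v → Mark m n
  row G x = if adj G zero (suc x) then e else none

  present-row : (G : SimpleGraph (suc v)) → ∀ x → adj G zero (suc x) ≡ present (row G x)
  present-row G x with adj G zero (suc x)
  ... | true  = ≡.sym e-present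
  ... | false = refl

  extend-underlying : (G : SimpleGraph (suc v)) {M : MixedGraph m n v} →
    HasUnderlying M (delete G) → HasUnderlying (extend M (row G)) G
  extend-underlying G u zero    zero    = irrefl G zero
  extend-underlying G u zero    (suc y) = present-row G y
  extend-underlying G u (suc x) zero    =
    ≡.trans (SimpleGraph.sym G (suc x) zero)
            (≡.trans (present-row G x) (≡.sym (present-flip (row G x))))
  extend-underlying G u (suc x) (suc y) = u x y

  paint : (G : SimpleGraph v) → Σ (MixedGraph m n v) λ M → HasUnderlying M G
  paint {v = zero}  G = empty , λ ()
  paint {v = suc v} G =
    let M , u = paint (delete G) in extend M (row G) , extend-underlying G {M} u

  chi-exists : (G : SimpleGraph v) → ∃ (IsChi m n G)
  chi-exists {v} G
    with least (bounded? {m = m} {n} G) (λ b M u → Colourable-suc {M = M} (b M u)) v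
               -- Mapping a graph identically to itself shows that `v` colours always suffice.
               (λ M _ → M , id , λ _ _ _ → refl)
  ... | k , b , minimal = k , upper , attained k b minimal
    where
    upper : ∀ M → HasUnderlying M G → ∃[ j ] (IsChiMixed M j × j ≤ k)
    upper M u with least (colourable? M) (Colourable-suc {M = M}) k (b M u)
    ... | j , c , min = j , (c , λ i H h → min i (H , h)) , min k (b M u)

    attained : ∀ k → Bounded m n G k → (∀ j → Bounded m n G j → k ≤ j) →
               Σ (MixedGraph m n v) λ M → HasUnderlying M G × IsChiMixed M k
    -- There is no smaller bound to refute here, so any mixed graph over `G` attains the maximum.
    attained zero b _ = let M , u = paint G in M , u , b M u , λ _ _ _ → z≤n
    -- By minimality `k` colours fail for some mixed graph, and that graph attains `suc k`.
    attained (suc k) b minimal with uncolourable? {m = m} {n} G k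
    ... | yes (M , u , ¬c) = M , u , b M u ,
          λ j H h → ℕ.≰⇒> λ j≤k → ¬c (Colourable-mono {M = M} j≤k (H , h))
    ... | no ¬∃ = contradiction
          (minimal k λ M u → decidable-stable (colourable? M k) λ ¬c → ¬∃ (M , u , ¬c))
          ℕ.1+n≰n

  -- Every mixed graph over the smaller graph extends to one over `G`, and a colouring of the
  -- extension restricts.
  bounded-delete : (G : SimpleGraph (suc v)) {k : ℕ} → Bounded m n G k → Bounded m n (delete G) k
  bounded-delete G b M u with b (extend M (row G)) (extend-underlying G {M} u)
  ... | H , f , hom = H , f ∘ suc , λ x y → hom (suc x) (suc y)

chi-bounded : (G : SimpleGraph v) {k : ℕ} → IsChi m n G k → Bounded m n G k
chi-bounded G (upper , _) M u with upper M u
... | j , (c , _) , j≤k = Colourable-mono {M = M} j≤k c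

chi-≤ : (G : SimpleGraph v) {k l : ℕ} → IsChi m n G k → Bounded m n G l → k ≤ l
chi-≤ G (_ , M , u , _ , minimal) b = let H , h = b M u in minimal _ H h

chi-≥ : (G : SimpleGraph v) {k l : ℕ} → IsChi m n G k → Demands m n G l → l ≤ k
chi-≥ G χ (M , u , minimal) = minimal _ (chi-bounded G χ M u)

-- Vertices whose neighbourhood is a clique.

Simplicial : {A : Set} → (A → A → Bool) → A → Set
Simplicial _~_ x = ∀ y z → y ≢ z → (x ~ y) ≡ true → (x ~ z) ≡ true → (y ~ z) ≡ true

-- The new vertex gets a colour of its own. That colour can meet each old colour in one way
-- only, but neighbours of a simplicial vertex are adjacent, so no two of them share a colour.
bounded-simplicial : (G : SimpleGraph (suc v)) → Simplicial (adj G) zero →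
  {k : ℕ} → Bounded m n (delete G) k → Bounded m n G (suc k)
bounded-simplicial {v} {m} {n} G simp {k} b M u with b (tail M) (λ x y → u (suc x) (suc y))
... | H , f , hom = extend H r , f′ , hom′
  where
  meets? : ∀ j → Dec (∃ λ x → f x ≡ j × adj G zero (suc x) ≡ true)
  meets? j = Fin.any? λ x → (f x Fin.≟ j) ×-dec (adj G zero (suc x) Bool.≟ true)

  r : Fin k → Mark m n
  r j with meets? j
  ... | yes (x , _) = mark M zero (suc x)
  ... | no _        = none

  f′ : Fin (suc v) → Fin (suc k)
  f′ zero    = zero
  f′ (suc x) = suc (f x)

  injective-on-neighbours : ∀ x y → adj G zero (suc x) ≡ true → adj G zero (suc y) ≡ true →
                            f x ≡ f y → x ≡ y
  injective-on-neighbours x y px py fx≡fy with x Fin.≟ y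
  ... | yes x≡y = x≡y
  ... | no  x≢y = contradiction
    (begin
      true                               ≡⟨ present-xy ⟨
      present (mark M (suc x) (suc y))   ≡⟨ cong present (hom x y present-xy) ⟨
      present (mark H (f x) (f y))       ≡⟨ cong (λ j → present (mark H j (f y))) fx≡fy ⟩
      present (mark H (f y) (f y))       ≡⟨ cong present (mark-loop H (f y)) ⟩
      false                              ∎)
    (λ ())
    where
    open ≡.≡-Reasoning
    present-xy : present (mark M (suc x) (suc y)) ≡ true
    present-xy = ≡.trans (≡.sym (u (suc x) (suc y)))
      (simp (suc x) (suc y) (λ { refl → x≢y refl }) px py)

  r-neighbour : ∀ x → adj G zero (suc x) ≡ true → r (f x) ≡ mark M zero (suc x)
  r-neighbour x px with meets? (f x)
  ... | yes (y , fy≡fx , py) = cong (mark M zero ∘ suc) (injective-on-neighbours y x py px fy≡fx)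
  ... | no ¬∃ = contradiction (x , refl , px) ¬∃

  hom′ : IsHom M (extend H r) f′
  hom′ zero    zero    p = ≡.sym (mark-loop M zero)
  hom′ zero    (suc y) p = r-neighbour y (≡.trans (u zero (suc y)) p)
  hom′ (suc x) zero    p = ≡.trans
    (cong flip (r-neighbour x
      (≡.trans (SimpleGraph.sym G zero (suc x)) (≡.trans (u (suc x) zero) p))))
    (≡.sym (mark-flip M zero (suc x)))
  hom′ (suc x) (suc y) p = hom x y p

-- Since `suc L ↑ʳ x` computes to `suc (L ↑ʳ x)`, dropping `suc L` vertices is definitionally one
-- `delete` followed by dropping `L`.
drop : ∀ L → SimpleGraph (L + v) → SimpleGraph v
drop L G = record
  { adj    = λ x y → adj G (L ↑ʳ x) (L ↑ʳ y)
  ; sym    = λ x y → SimpleGraph.sym G (L ↑ʳ x) (L ↑ʳ y)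
  ; irrefl = λ x → irrefl G (L ↑ʳ x)
  }

-- Interpolation of the difference.

Realises : ℤ → Set
Realises z = ∃[ v ] Σ (SimpleGraph v) λ G → ∃[ a ] ∃[ b ]
               (IsChi 0 2 G a × IsChi 1 0 G b × (+ a - + b ≡ z))

-- Abstract, as unfolding the exhaustive search is expensive.
abstract
  χ₀₂ : (G : SimpleGraph v) → ∃ (IsChi 0 2 G)
  χ₀₂ = chi-exists (edge zero) refl

  χ₁₀ : (G : SimpleGraph v) → ∃ (IsChi 1 0 G)
  χ₁₀ = chi-exists (out zero) refl

-- The target difference is p - q, and comparisons are shifted by p and q to avoid subtraction.
module Interpolation (p q : ℕ) where

  Above Below : SimpleGraph v → Set
  Above G = proj₁ (χ₁₀ G) + p ≤ proj₁ (χ₀₂ G) + q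
  Below G = proj₁ (χ₀₂ G) + q ≤ proj₁ (χ₁₀ G) + p

  balanced : (G : SimpleGraph v) → proj₁ (χ₀₂ G) + q ≡ proj₁ (χ₁₀ G) + p → Realises (p ⊖ q)
  balanced G eq = _ , G , _ , _ , proj₂ (χ₀₂ G) , proj₂ (χ₁₀ G) , (begin
      + a - + b         ≡⟨ ℤ.m-n≡m⊖n a b ⟩
      a ⊖ b             ≡⟨ ℤ.+-cancelˡ-⊖ q a b ⟨
      (q + a) ⊖ (q + b) ≡⟨ cong₂ _⊖_ (≡.trans (ℕ.+-comm q a) eq) (ℕ.+-comm q b) ⟩
      (b + p) ⊖ (b + q) ≡⟨ ℤ.+-cancelˡ-⊖ b p q ⟩
      p ⊖ q             ∎)
    where
    open ≡.≡-Reasoning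
    a = proj₁ (χ₀₂ G)
    b = proj₁ (χ₁₀ G)

  -- Deleting a simplicial vertex lowers `χ₀₂` by at most one and never raises `χ₁₀`. A difference
  -- strictly above the target therefore cannot jump below it.
  descend : (G : SimpleGraph (suc v)) → Simplicial (adj G) zero →
            Above G → Realises (p ⊖ q) ⊎ Above (delete G)
  descend G simp above with ℕ.m≤n⇒m<n∨m≡n above
  ... | inj₂ eq = inj₁ (balanced G (≡.sym eq))
  ... | inj₁ lt = inj₂ (ℕ.≤-pred (begin-strict
      proj₁ (χ₁₀ (delete G)) + p       ≤⟨ ℕ.+-monoˡ-≤ p shrink ⟩
      proj₁ (χ₁₀ G) + p                <⟨ lt ⟩
      proj₁ (χ₀₂ G) + q                ≤⟨ ℕ.+-monoˡ-≤ q grow ⟩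
      suc (proj₁ (χ₀₂ (delete G)) + q) ∎))
    where
    open ℕ.≤-Reasoning
    shrink : proj₁ (χ₁₀ (delete G)) ≤ proj₁ (χ₁₀ G)
    shrink = chi-≤ (delete G) (proj₂ (χ₁₀ (delete G)))
      (bounded-delete (out zero) refl G (chi-bounded G (proj₂ (χ₁₀ G))))
    grow : proj₁ (χ₀₂ G) ≤ suc (proj₁ (χ₀₂ (delete G)))
    grow = chi-≤ G (proj₂ (χ₀₂ G))
      (bounded-simplicial G simp (chi-bounded (delete G) (proj₂ (χ₀₂ (delete G)))))

  -- The remaining vertices stay simplicial, because `delete` passes to an induced subgraph.
  descend-many : ∀ L (G : SimpleGraph (L + v)) → (∀ x → Simplicial (adj G) (x ↑ˡ v)) →
                 Above G → Realises (p ⊖ q) ⊎ Above (drop L G)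
  descend-many zero    G simp above = inj₂ above
  descend-many (suc L) G simp above with descend G (simp zero) above
  ... | inj₁ r      = inj₁ r
  ... | inj₂ above′ = descend-many L (delete G)
    (λ x y z y≢z → simp (suc x) (suc y) (suc z) λ { refl → y≢z refl }) above′

  meet : (G : SimpleGraph v) → Above G → Below G → Realises (p ⊖ q)
  meet G above below = balanced G (ℕ.≤-antisym below above)

  above-if : (G : SimpleGraph v) {a b : ℕ} → Demands 0 2 G a → Bounded 1 0 G b →
             b + p ≤ a + q → Above G
  above-if G d b le = ℕ.≤-trans (ℕ.+-monoˡ-≤ p (chi-≤ G (proj₂ (χ₁₀ G)) b))
    (ℕ.≤-trans le (ℕ.+-monoˡ-≤ q (chi-≥ G (proj₂ (χ₀₂ G)) d)))

  below-if : (G : SimpleGraph v) {a b : ℕ} → Bounded 0 2 G a → Demands 1 0 G b →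
             a + q ≤ b + p → Below G
  below-if G b d le = ℕ.≤-trans (ℕ.+-monoˡ-≤ q (chi-≤ G (proj₂ (χ₀₂ G)) b))
    (ℕ.≤-trans le (ℕ.+-monoˡ-≤ p (chi-≥ G (proj₂ (χ₁₀ G)) d)))

-- Graphs on structured vertex types.

to-injective : (ψ : A ↔ B) → Injective _≡_ _≡_ (to ψ)
to-injective ψ {x} {y} eq = ≡.trans (≡.sym (strictlyInverseʳ ψ x))
  (≡.trans (cong (from ψ) eq) (strictlyInverseʳ ψ y))

-- Mixed graphs on an arbitrary type let the constructions match on sums and products instead of
-- computing with indices in `Fin`.
record Marking (m n : ℕ) (A : Set) : Set where
  field
    mk      : A → A → Mark m n
    mk-flip : ∀ a b → mk b a ≡ flip (mk a b)
    mk-loop : ∀ a → mk a a ≡ none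
open Marking

Preserves : Marking m n A → Marking m n B → (A → B) → Set
Preserves M H f = ∀ a b → present (mk M a b) ≡ true → mk H (f a) (f b) ≡ mk M a b

onFin : (Fin v → A) → Marking m n A → MixedGraph m n v
onFin f M = record
  { mark      = λ x y → mk M (f x) (f y)
  ; mark-flip = λ x y → mk-flip M (f x) (f y)
  ; mark-loop = λ x → mk-loop M (f x)
  }

along : (A → Fin v) → MixedGraph m n v → Marking m n A
along f M = record
  { mk      = λ x y → mark M (f x) (f y)
  ; mk-flip = λ x y → mark-flip M (f x) (f y)
  ; mk-loop = λ x → mark-loop M (f x)
  }

underlying : MixedGraph m n v → SimpleGraph v
underlying M = record
  { adj    = λ x y → present (mark M x y)
  ; sym    = λ x y → ≡.sym (≡.trans (cong present (mark-flip M x y)) (present-flip (mark M x y)))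
  ; irrefl = λ x → cong present (mark-loop M x)
  }

graph : Fin v ↔ A → Marking m n A → SimpleGraph v
graph ψ M = underlying (onFin (to ψ) M)

-- `M₀` fixes the adjacency, while the colourings range over `M`; hence its palette may differ from
-- that of `M`.
bounded-via : (ψ : Fin v ↔ A) (M₀ : Marking m′ n′ A) (β : Fin k ↔ B) →
  (∀ (M : Marking m n A) → (∀ a b → present (mk M₀ a b) ≡ present (mk M a b)) →
     Σ (Marking m n B) λ H → Σ (A → B) (Preserves M H)) →
  Bounded m n (graph ψ M₀) k
bounded-via ψ M₀ β colour M u
  with colour (along (from ψ) M)
         (λ a b → ≡.trans (≡.sym (cong₂ (λ a b → present (mk M₀ a b))
                                       (strictlyInverseˡ ψ a) (strictlyInverseˡ ψ b)))
                         (u (from ψ a) (from ψ b)))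
... | H , f , pres = onFin (to β) H , from β ∘ f ∘ to ψ , hom
  where
  unfold : ∀ x y → mark M (from ψ (to ψ x)) (from ψ (to ψ y)) ≡ mark M x y
  unfold x y = cong₂ (mark M) (strictlyInverseʳ ψ x) (strictlyInverseʳ ψ y)

  hom : IsHom M (onFin (to β) H) (from β ∘ f ∘ to ψ)
  hom x y p = begin
    mk H (to β (from β (f (to ψ x)))) (to β (from β (f (to ψ y))))
      ≡⟨ cong₂ (mk H) (strictlyInverseˡ β _) (strictlyInverseˡ β _) ⟩
    mk H (f (to ψ x)) (f (to ψ y))
      ≡⟨ pres (to ψ x) (to ψ y) (≡.trans (cong present (unfold x y)) p) ⟩
    mark M (from ψ (to ψ x)) (from ψ (to ψ y))
      ≡⟨ unfold x y ⟩
    mark M x y ∎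
    where open ≡.≡-Reasoning

-- An injection from a type of size `k` into the vertices of every target forces each target to have
-- at least `k` vertices.
demands-via : (ψ : Fin v ↔ A) (M₀ : Marking m n A) (γ : Fin k ↔ C) →
  (∀ {j} (H : MixedGraph m n j) (g : A → Fin j) → Preserves M₀ (along id H) g →
     Σ (C → Fin j) (Injective _≡_ _≡_)) →
  Demands m n (graph ψ M₀) k
demands-via ψ M₀ γ pick = onFin (to ψ) M₀ , (λ _ _ → refl) , bound
  where
  bound : ∀ j → Colourable (onFin (to ψ) M₀) j → _ ≤ j
  bound j (H , f , hom) with pick H (f ∘ from ψ) pres
    where
    pres : Preserves M₀ (along id H) (f ∘ from ψ)
    pres a b rewrite ≡.sym (strictlyInverseˡ ψ a) | ≡.sym (strictlyInverseˡ ψ b)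
                   | strictlyInverseʳ ψ (from ψ a) | strictlyInverseʳ ψ (from ψ b)
                   = hom (from ψ a) (from ψ b)
  ... | h , h-injective = Fin.injective⇒≤ {f = h ∘ to γ} (to-injective γ ∘ h-injective)

-- Folding 2-edge-coloured pentagons.

flip-edge : (a : Mark 0 n) → flip a ≡ a
flip-edge none     = refl
flip-edge (edge _) = refl

colour : Mark 0 2 → Fin 2
colour (edge c) = c
colour none     = zero

edge-colour : (a : Mark 0 2) → present a ≡ true → edge (colour a) ≡ a
edge-colour (edge c) _ = refl

≢-≢⇒≡ : {a b c : Fin 2} → a ≢ b → b ≢ c → a ≡ c
≢-≢⇒≡ {zero}     {b}        {zero}     _ _ = refl
≢-≢⇒≡ {suc zero} {b}        {suc zero} _ _ = refl
≢-≢⇒≡ {zero}     {zero}     {suc zero} p _ = contradiction refl p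
≢-≢⇒≡ {zero}     {suc zero} {suc zero} _ q = contradiction refl q
≢-≢⇒≡ {suc zero} {zero}     {zero}     _ q = contradiction refl q
≢-≢⇒≡ {suc zero} {suc zero} {zero}     p _ = contradiction refl p

next : Fin 5 → Fin 5
next zero                         = suc zero
next (suc zero)                   = suc (suc zero)
next (suc (suc zero))             = suc (suc (suc zero))
next (suc (suc (suc zero)))       = suc (suc (suc (suc zero)))
next (suc (suc (suc (suc zero)))) = zero

next⁴ : Fin 5 → Fin 5
next⁴ p = next (next (next (next p)))

next-next⁴ : ∀ p → next (next⁴ p) ≡ p
next-next⁴ = from-yes (Fin.all? λ p → next (next⁴ p) Fin.≟ p)

next²≢ : ∀ p → next (next p) ≢ p
next²≢ = from-yes (Fin.all? λ p → ¬? (next (next p) Fin.≟ p))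

next≢ : ∀ p → next p ≢ p
next≢ = from-yes (Fin.all? λ p → ¬? (next p Fin.≟ p))

-- Any two vertices of a directed 5-cycle are joined, one way or the other, by a directed path of
-- length one or two; this is what forces their colours apart.
cycle-distance : ∀ p q → p ≢ q →
  (q ≡ next p ⊎ p ≡ next q) ⊎ (q ≡ next (next p) ⊎ p ≡ next (next q))
cycle-distance = from-yes (Fin.all? λ p → Fin.all? λ q → ¬? (p Fin.≟ q) →-dec
  ((q Fin.≟ next p ⊎-dec p Fin.≟ next q) ⊎-dec (q Fin.≟ next (next p) ⊎-dec p Fin.≟ next (next q))))

-- `e p` is the colour of the edge from `p` to `next p`. The opposite direction follows from the
-- symmetry of edge marks.
Fold : (Fin 5 → Fin 2) → Set
Fold e = Σ (Marking 0 2 (Fin 4)) λ T → Σ (Fin 5 → Fin 4) λ f →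
           ∀ p → mk T (f p) (f (next p)) ≡ edge (e p)

-- `next⁴` inverts `next`, so precomposing with it undoes the rotation.
fold-rotate : (e : Fin 5 → Fin 2) → Fold (e ∘ next) → Fold e
fold-rotate e (T , f , hom) = T , f ∘ next⁴ , λ p →
  ≡.trans (hom (next⁴ p)) (cong (edge ∘ e) (next-next⁴ p))

-- Vertices 1 and 4 are identified.
fold-at-zero : (e : Fin 5 → Fin 2) → e zero ≡ e (suc (suc (suc (suc zero)))) → Fold e
fold-at-zero e e₀≡e₄ = record { mk = T ; mk-flip = T-flip ; mk-loop = T-loop } , f , hom
  where
  T : Fin 4 → Fin 4 → Mark 0 2
  T zero             (suc zero)             = edge (e zero)
  T (suc zero)       zero                   = edge (e zero)
  T (suc zero)       (suc (suc zero))       = edge (e (suc zero))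
  T (suc (suc zero)) (suc zero)             = edge (e (suc zero))
  T (suc (suc zero)) (suc (suc (suc zero))) = edge (e (suc (suc zero)))
  T (suc (suc (suc zero))) (suc (suc zero)) = edge (e (suc (suc zero)))
  T (suc (suc (suc zero))) (suc zero)       = edge (e (suc (suc (suc zero))))
  T (suc zero) (suc (suc (suc zero)))       = edge (e (suc (suc (suc zero))))
  T _ _ = none

  T-flip : ∀ a b → T b a ≡ flip (T a b)
  T-flip zero zero = refl
  T-flip zero (suc zero) = refl
  T-flip zero (suc (suc zero)) = refl
  T-flip zero (suc (suc (suc zero))) = refl
  T-flip (suc zero) zero = refl
  T-flip (suc zero) (suc zero) = refl
  T-flip (suc zero) (suc (suc zero)) = refl
  T-flip (suc zero) (suc (suc (suc zero))) = refl
  T-flip (suc (suc zero)) zero = refl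
  T-flip (suc (suc zero)) (suc zero) = refl
  T-flip (suc (suc zero)) (suc (suc zero)) = refl
  T-flip (suc (suc zero)) (suc (suc (suc zero))) = refl
  T-flip (suc (suc (suc zero))) zero = refl
  T-flip (suc (suc (suc zero))) (suc zero) = refl
  T-flip (suc (suc (suc zero))) (suc (suc zero)) = refl
  T-flip (suc (suc (suc zero))) (suc (suc (suc zero))) = refl

  T-loop : ∀ a → T a a ≡ none
  T-loop zero                   = refl
  T-loop (suc zero)             = refl
  T-loop (suc (suc zero))       = refl
  T-loop (suc (suc (suc zero))) = refl

  f : Fin 5 → Fin 4
  f zero                         = zero
  f (suc zero)                   = suc zero
  f (suc (suc zero))             = suc (suc zero)
  f (suc (suc (suc zero)))       = suc (suc (suc zero))
  f (suc (suc (suc (suc zero)))) = suc zero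

  hom : ∀ p → T (f p) (f (next p)) ≡ edge (e p)
  hom zero                         = refl
  hom (suc zero)                   = refl
  hom (suc (suc zero))             = refl
  hom (suc (suc (suc zero)))       = refl
  -- The edge from 4 to 0 lands on the edge between 0 and 1, which carries `e zero`.
  hom (suc (suc (suc (suc zero)))) = cong edge e₀≡e₄

-- Two colours cannot alternate around an odd cycle, so some vertex sees one colour twice.
fold-C₅ : (e : Fin 5 → Fin 2) → Fold e
fold-C₅ e
  with e zero Fin.≟ e (next⁴ zero)
     | e (suc zero) Fin.≟ e zero
     | e (suc (suc zero)) Fin.≟ e (suc zero)
     | e (suc (suc (suc zero))) Fin.≟ e (suc (suc zero))
     | e (next⁴ zero) Fin.≟ e (suc (suc (suc zero)))
... | yes p | _ | _ | _ | _ = fold-at-zero e p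
... | _ | yes p | _ | _ | _ = fold-rotate e (fold-at-zero _ p)
... | _ | _ | yes p | _ | _ = fold-rotate e (fold-rotate _ (fold-at-zero _ p))
... | _ | _ | _ | yes p | _ = fold-rotate e (fold-rotate _ (fold-rotate _ (fold-at-zero _ p)))
... | _ | _ | _ | _ | yes p =
  fold-rotate e (fold-rotate _ (fold-rotate _ (fold-rotate _ (fold-at-zero _ p))))
... | no p₀ | no p₁ | no p₂ | no p₃ | no p₄ =
  -- Colours two steps apart agree, so the edges 4, 2 and 0 share a colour, although 4 and 0 are
  -- consecutive.
  contradiction (≡.sym (≡.trans (≢-≢⇒≡ p₄ p₃) (≢-≢⇒≡ p₂ p₁))) p₀

-- Binary digits and distinctness in targets.

digit-distinguishes : ∀ {i j : Fin (2 ^ k)} → i ≢ j → ∃ λ l → finToFun {2} {k} i l ≢ finToFun j l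
digit-distinguishes {k} {i} {j} i≢j
  with Fin.any? (λ l → ¬? (finToFun {2} {k} i l Fin.≟ finToFun j l))
... | yes d = d
... | no ¬d = contradiction
  -- Indices with the same digits coincide, as `funToFin` reads each index back from its digits.
  (≡.trans (≡.sym (Fin.funToFin-finToFin {k} {2} i))
    (≡.trans (funToFin-cong λ l → decidable-stable (_ Fin.≟ _) λ ne → ¬d (l , ne))
             (Fin.funToFin-finToFin {k} {2} j)))
  i≢j
  where
  funToFin-cong : ∀ {a b} {f g : Fin a → Fin b} → f ≗ g → funToFin f ≡ funToFin g
  funToFin-cong {zero}  f≗g = refl
  funToFin-cong {suc a} f≗g = cong₂ combine (f≗g zero) (funToFin-cong (f≗g ∘ suc))

-- Addition modulo two.
_⊕_ : Fin 2 → Fin 2 → Fin 2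
zero     ⊕ t = t
suc zero ⊕ t = opposite t

⊕-cancel : ∀ s t → (s ⊕ t) ⊕ t ≡ s
⊕-cancel = from-yes (Fin.all? λ s → Fin.all? λ t → ((s ⊕ t) ⊕ t) Fin.≟ s)

-- Distinct `s` and `t` sum to one, and adding one to `p` gives the only other value.
⊕-separates : ∀ p q s t → p ≢ q → s ≢ t → (p ⊕ s) ⊕ t ≡ q
⊕-separates = from-yes (Fin.all? λ p → Fin.all? λ q → Fin.all? λ s → Fin.all? λ t →
  ¬? (p Fin.≟ q) →-dec (¬? (s Fin.≟ t) →-dec (((p ⊕ s) ⊕ t) Fin.≟ q)))

adjacent-distinct : (H : MixedGraph m n v) {a b : Fin v} {c : Mark m n} →
  mark H a b ≡ c → present c ≡ true → a ≢ b
adjacent-distinct H eq p refl =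
  contradiction (≡.trans (≡.sym p) (cong present (≡.trans (≡.sym eq) (mark-loop H _)))) (λ ())

-- If the ends coincided, one pair of vertices would carry arcs in both directions.
dipath-ends-distinct : (H : MixedGraph 1 0 v) {a b c : Fin v} →
  mark H a b ≡ out zero → mark H b c ≡ out zero → a ≢ c
dipath-ends-distinct H ab bc refl =
  contradiction (≡.trans (≡.sym bc) (≡.trans (mark-flip H _ _) (cong flip ab))) (λ ())

-- The start: disjoint pentagons joined through hubs.

module Pentagons (k : ℕ) where

  N : ℕ
  N = 2 ^ k

  -- Every ordered pair of core vertices indexes a hub, which keeps `Hub` a plain product. Hubs of
  -- pairs within one pentagon are left isolated by `spoke`.
  Core Hub Vertex : Set
  Core   = Fin N × Fin 5
  Hub    = Core × Core
  Vertex = Core ⊎ Hub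

  v₀ : ℕ
  v₀ = N * 5 + (N * 5) * (N * 5)

  vertices : Fin v₀ ↔ Vertex
  vertices = ↔-trans +↔⊎ (*↔× ⊎-↔ ↔-trans *↔× (*↔× ×-↔ *↔×))

  _≟ᶜ_ : DecidableEquality Core
  _≟ᶜ_ = ≡-dec Fin._≟_ Fin._≟_

  cyclic : Fin 5 → Fin 5 → Mark 1 0
  cyclic p q with q Fin.≟ next p | p Fin.≟ next q
  ... | yes _ | _     = out zero
  ... | no _  | yes _ = inc zero
  ... | no _  | no _  = none

  cyclic-flip : ∀ p q → cyclic q p ≡ flip (cyclic p q)
  cyclic-flip p q with q Fin.≟ next p | p Fin.≟ next q
  ... | yes refl | yes eq = contradiction (≡.sym eq) (next²≢ p)
  ... | yes _    | no _   = refl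
  ... | no _     | yes _  = refl
  ... | no _     | no _   = refl

  cyclic-loop : ∀ p → cyclic p p ≡ none
  cyclic-loop p with p Fin.≟ next p
  ... | yes eq = contradiction (≡.sym eq) (next≢ p)
  ... | no _   = refl

  cyclic-next : ∀ p → cyclic p (next p) ≡ out zero
  cyclic-next p with next p Fin.≟ next p
  ... | yes _ = refl
  ... | no ne = contradiction refl ne

  cyclic-present : ∀ p q → present (cyclic p q) ≡ true → q ≡ next p ⊎ p ≡ next q
  cyclic-present p q pr with q Fin.≟ next p | p Fin.≟ next q
  ... | yes eq | _      = inj₁ eq
  ... | no _   | yes eq = inj₂ eq

  rim : Core → Core → Mark 1 0
  rim (i , p) (j , q) with i Fin.≟ j
  ... | yes _ = cyclic p q
  ... | no _  = none

  rim-flip : ∀ x y → rim y x ≡ flip (rim x y)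
  rim-flip (i , p) (j , q) with i Fin.≟ j | j Fin.≟ i
  ... | yes _  | yes _  = cyclic-flip p q
  ... | yes eq | no ne  = contradiction (≡.sym eq) ne
  ... | no ne  | yes eq = contradiction (≡.sym eq) ne
  ... | no _   | no _   = refl

  rim-loop : ∀ x → rim x x ≡ none
  rim-loop (i , p) with i Fin.≟ i
  ... | yes _ = cyclic-loop p
  ... | no _  = refl

  rim-next : ∀ i p → rim (i , p) (i , next p) ≡ out zero
  rim-next i p with i Fin.≟ i
  ... | yes _ = cyclic-next p
  ... | no ne = contradiction refl ne

  rim-present : ∀ i p j q → present (rim (i , p) (j , q)) ≡ true →
                i ≡ j × (q ≡ next p ⊎ p ≡ next q)
  rim-present i p j q pr with i Fin.≟ j
  ... | yes eq = eq , cyclic-present p q pr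

  spoke : Core → Hub → Mark 1 0
  spoke c (x , y) with proj₁ x Fin.≟ proj₁ y | c ≟ᶜ x | c ≟ᶜ y
  ... | yes _ | _     | _     = none
  ... | no _  | yes _ | _     = out zero
  ... | no _  | no _  | yes _ = inc zero
  ... | no _  | no _  | no _  = none

  spoke-out : ∀ x y → proj₁ x ≢ proj₁ y → spoke x (x , y) ≡ out zero
  spoke-out x y ne with proj₁ x Fin.≟ proj₁ y | x ≟ᶜ x
  ... | yes eq | _     = contradiction eq ne
  ... | no _   | yes _ = refl
  ... | no _   | no ¬p = contradiction refl ¬p

  spoke-inc : ∀ x y → proj₁ x ≢ proj₁ y → spoke y (x , y) ≡ inc zero
  spoke-inc x y ne with proj₁ x Fin.≟ proj₁ y | y ≟ᶜ x | y ≟ᶜ y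
  ... | yes eq | _        | _     = contradiction eq ne
  ... | no _   | yes refl | _     = contradiction refl ne
  ... | no _   | no _     | yes _ = refl
  ... | no _   | no _     | no ¬p = contradiction refl ¬p

  spoke-present : ∀ c x y → present (spoke c (x , y)) ≡ true →
                  proj₁ x ≢ proj₁ y × (c ≡ x ⊎ c ≡ y)
  spoke-present c x y pr with proj₁ x Fin.≟ proj₁ y | c ≟ᶜ x | c ≟ᶜ y
  ... | no ne | yes eq | _      = ne , inj₁ eq
  ... | no ne | no _   | yes eq = ne , inj₂ eq

  -- Each pentagon is a directed cycle, and each hub is the middle of a directed path between
  -- core vertices of different pentagons: all core vertices must receive different colours.
  marking : Marking 1 0 Vertex
  marking = record { mk = mk₀ ; mk-flip = flip₀ ; mk-loop = loop₀ }
    where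
    mk₀ : Vertex → Vertex → Mark 1 0
    mk₀ (inj₁ c) (inj₁ d) = rim c d
    mk₀ (inj₁ c) (inj₂ h) = spoke c h
    mk₀ (inj₂ h) (inj₁ c) = flip (spoke c h)
    mk₀ (inj₂ _) (inj₂ _) = none

    flip₀ : ∀ a b → mk₀ b a ≡ flip (mk₀ a b)
    flip₀ (inj₁ c) (inj₁ d) = rim-flip c d
    flip₀ (inj₁ c) (inj₂ h) = refl
    flip₀ (inj₂ h) (inj₁ c) = ≡.sym (flip-involutive (spoke c h))
    flip₀ (inj₂ _) (inj₂ _) = refl

    loop₀ : ∀ a → mk₀ a a ≡ none
    loop₀ (inj₁ c) = rim-loop c
    loop₀ (inj₂ _) = refl

  G : SimpleGraph v₀
  G = graph vertices marking

  demands : Demands 1 0 G (N * 5)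
  demands = demands-via vertices marking *↔×
    λ H g pres → g ∘ inj₁ , λ {x} {y} → injective H g pres x y
    where
    injective : ∀ {j} (H : MixedGraph 1 0 j) (g : Vertex → Fin j) →
      Preserves marking (along id H) g → ∀ x y → g (inj₁ x) ≡ g (inj₁ y) → x ≡ y
    injective H g pres x@(i , p) y@(j , q) gx≡gy = decidable-stable (x ≟ᶜ y) λ x≢y → go x≢y gx≡gy
      where
      arc : ∀ a b → mk marking a b ≡ out zero → mark H (g a) (g b) ≡ out zero
      arc a b eq = ≡.trans (pres a b (cong present eq)) eq

      rim-arc : ∀ i p → mark H (g (inj₁ (i , p))) (g (inj₁ (i , next p))) ≡ out zero
      rim-arc i p = arc _ _ (rim-next i p)

      go : x ≢ y → g (inj₁ x) ≢ g (inj₁ y)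
      go x≢y with i Fin.≟ j
      ... | no i≢j = dipath-ends-distinct H
              (arc _ (inj₂ (x , y)) (spoke-out x y i≢j))
              (arc _ _ (cong flip (spoke-inc x y i≢j)))
      -- Within one pentagon the cycle itself supplies the arc or the directed path of length two.
      ... | yes refl with cycle-distance p q (λ { refl → x≢y refl })
      ... | inj₁ (inj₁ refl) = adjacent-distinct H (rim-arc i p) refl
      ... | inj₁ (inj₂ refl) = adjacent-distinct H (rim-arc i q) refl ∘ ≡.sym
      ... | inj₂ (inj₁ refl) = dipath-ends-distinct H (rim-arc i p) (rim-arc i (next p))
      ... | inj₂ (inj₂ refl) = dipath-ends-distinct H (rim-arc i q) (rim-arc i (next q)) ∘ ≡.sym

  HubColour Colour : Set
  HubColour = Fin 2 ⊎ (Fin k × Fin 2)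
  Colour    = (Fin N × Fin 4) ⊎ HubColour

  colours : Fin (N * 4 + (2 + k * 2)) ↔ Colour
  colours = ↔-trans +↔⊎ (*↔× ⊎-↔ ↔-trans +↔⊎ (↔-refl ⊎-↔ *↔×))

  -- The edge colour between a hub colour and all four colours of pentagon `i`: either constant, or
  -- a binary digit of `i`, possibly complemented.
  sees : HubColour → Fin N → Fin 2
  sees (inj₁ s)       i = s
  sees (inj₂ (l , s)) i = s ⊕ finToFun {2} {k} i l

  -- Equal requirements are met by a constant hub colour. Different ones are met by a digit in which
  -- `i` and `j` differ, complemented if necessary.
  hub-colour : ∀ {i j} → i ≢ j → ∀ p q → Σ HubColour λ h → sees h i ≡ p × sees h j ≡ q
  hub-colour i≢j p q with p Fin.≟ q
  ... | yes p≡q = inj₁ p , refl , p≡q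
  ... | no  p≢q with digit-distinguishes {k} i≢j
  ... | l , ne = inj₂ (l , p ⊕ _) , ⊕-cancel p _ , ⊕-separates p q _ _ p≢q ne

  -- Every pentagon can be folded onto four colours. As pentagons are told apart by the k binary
  -- digits of their index, 2k + 2 hub colours suffice for all hubs.
  bounded : Bounded 0 2 G (N * 4 + (2 + k * 2))
  bounded = bounded-via vertices marking colours colouring
    where
    colouring : (M : Marking 0 2 Vertex) →
      (∀ a b → present (mk marking a b) ≡ present (mk M a b)) →
      Σ (Marking 0 2 Colour) λ H → Σ (Vertex → Colour) (Preserves M H)
    colouring M u = record { mk = H ; mk-flip = H-flip ; mk-loop = H-loop } , f , pres
      where
      fold : ∀ i → Fold _
      fold i = fold-C₅ λ p → colour (mk M (inj₁ (i , p)) (inj₁ (i , next p)))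

      H : Colour → Colour → Mark 0 2
      H (inj₁ (i , s)) (inj₁ (j , t)) with i Fin.≟ j
      ... | yes _ = mk (proj₁ (fold i)) s t
      ... | no _  = none
      H (inj₁ (i , _)) (inj₂ h) = edge (sees h i)
      H (inj₂ h) (inj₁ (i , _)) = edge (sees h i)
      H (inj₂ _) (inj₂ _)       = none

      H-flip : ∀ a b → H b a ≡ flip (H a b)
      H-flip (inj₁ (i , s)) (inj₁ (j , t)) with i Fin.≟ j | j Fin.≟ i
      ... | yes refl | yes _  = mk-flip (proj₁ (fold i)) s t
      ... | yes eq   | no ne  = contradiction (≡.sym eq) ne
      ... | no ne    | yes eq = contradiction (≡.sym eq) ne
      ... | no _     | no _   = refl
      H-flip (inj₁ _) (inj₂ _) = refl
      H-flip (inj₂ _) (inj₁ _) = refl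
      H-flip (inj₂ _) (inj₂ _) = refl

      H-loop : ∀ a → H a a ≡ none
      H-loop (inj₁ (i , s)) with i Fin.≟ i
      ... | yes _ = mk-loop (proj₁ (fold i)) s
      ... | no _  = refl
      H-loop (inj₂ _) = refl

      spoke-colour : Core → Hub → Fin 2
      spoke-colour c h = colour (mk M (inj₁ c) (inj₂ h))

      paint-hub : Hub → HubColour
      paint-hub (x , y) with proj₁ x Fin.≟ proj₁ y
      -- Such a hub is isolated, so its colour is arbitrary.
      ... | yes _ = inj₁ zero
      ... | no ne = proj₁ (hub-colour ne (spoke-colour x (x , y)) (spoke-colour y (x , y)))

      f : Vertex → Colour
      f (inj₁ (i , p)) = inj₁ (i , proj₁ (proj₂ (fold i)) p)
      f (inj₂ h)       = inj₂ (paint-hub h)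

      sees-spoke : ∀ c h → present (spoke c h) ≡ true →
                   sees (paint-hub h) (proj₁ c) ≡ spoke-colour c h
      sees-spoke c (x , y) pr with spoke-present c x y pr | proj₁ x Fin.≟ proj₁ y
      ... | ne , _         | yes eq = contradiction eq ne
      ... | _  , inj₁ refl | no ne  =
        proj₁ (proj₂ (hub-colour ne (spoke-colour x (x , y)) (spoke-colour y (x , y))))
      ... | _  , inj₂ refl | no ne  =
        proj₂ (proj₂ (hub-colour ne (spoke-colour x (x , y)) (spoke-colour y (x , y))))

      mk-sym : ∀ a b → mk M a b ≡ mk M b a
      mk-sym a b = ≡.trans (≡.sym (flip-edge (mk M a b))) (≡.sym (mk-flip M a b))

      pres-spoke : ∀ c h → present (mk M (inj₁ c) (inj₂ h)) ≡ true →
                   H (f (inj₁ c)) (f (inj₂ h)) ≡ mk M (inj₁ c) (inj₂ h)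
      pres-spoke c h pr = ≡.trans
        (cong edge (sees-spoke c h (≡.trans (u (inj₁ c) (inj₂ h)) pr)))
        (edge-colour (mk M (inj₁ c) (inj₂ h)) pr)

      pres-next : ∀ i p → present (mk M (inj₁ (i , p)) (inj₁ (i , next p))) ≡ true →
        H (f (inj₁ (i , p))) (f (inj₁ (i , next p))) ≡ mk M (inj₁ (i , p)) (inj₁ (i , next p))
      pres-next i p pr with i Fin.≟ i
      ... | yes _ = ≡.trans (proj₂ (proj₂ (fold i)) p) (edge-colour _ pr)
      ... | no ne = contradiction refl ne

      H-sym : ∀ a b → H a b ≡ H b a
      H-sym a b = ≡.trans (≡.sym (flip-edge (H a b))) (≡.sym (H-flip a b))

      pres : ∀ a b → present (mk M a b) ≡ true → H (f a) (f b) ≡ mk M a b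
      pres (inj₁ (i , p)) (inj₁ (j , q)) pr
        with rim-present i p j q (≡.trans (u (inj₁ (i , p)) (inj₁ (j , q))) pr)
      ... | refl , inj₁ refl = pres-next i p pr
      ... | refl , inj₂ refl =
        ≡.trans (H-sym (f (inj₁ (i , next q))) (f (inj₁ (i , q))))
        (≡.trans (pres-next i q (≡.trans (cong present (mk-sym (inj₁ (i , q)) _)) pr))
                 (mk-sym (inj₁ (i , q)) _))
      pres (inj₁ c) (inj₂ h) pr = pres-spoke c h pr
      pres (inj₂ h) (inj₁ c) pr =
        ≡.trans (H-sym (f (inj₂ h)) (f (inj₁ c)))
        (≡.trans (pres-spoke c h (≡.trans (cong present (mk-sym (inj₁ c) (inj₂ h))) pr))
                 (mk-sym (inj₁ c) (inj₂ h)))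
      pres (inj₂ h) (inj₂ h′) pr = contradiction (≡.trans (u (inj₂ h) (inj₂ h′)) pr) λ ()

-- Transport along embeddings and pointwise equality.

simplicial-pull : {_~_ : A → A → Bool} {_~′_ : B → B → Bool} (φ : A → B) → Injective _≡_ _≡_ φ →
  (∀ x y → (x ~ y) ≡ (φ x ~′ φ y)) → ∀ {x} → Simplicial _~′_ (φ x) → Simplicial _~_ x
simplicial-pull φ φ-injective ~≡~′ simp y z y≢z x~y x~z = ≡.trans (~≡~′ y z)
  (simp (φ y) (φ z) (y≢z ∘ φ-injective)
    (≡.trans (≡.sym (~≡~′ _ y)) x~y) (≡.trans (≡.sym (~≡~′ _ z)) x~z))

_≐_ : SimpleGraph v → SimpleGraph v → Set
G ≐ G′ = ∀ x y → adj G x y ≡ adj G′ x y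

bounded-cong : {G G′ : SimpleGraph v} → G ≐ G′ → Bounded m n G k → Bounded m n G′ k
bounded-cong G≐G′ b M u = b M λ x y → ≡.trans (G≐G′ x y) (u x y)

demands-cong : {G G′ : SimpleGraph v} → G ≐ G′ → Demands m n G k → Demands m n G′ k
demands-cong G≐G′ (M , u , min) = M , (λ x y → ≡.trans (≡.sym (G≐G′ x y)) (u x y)) , min

-- Directions are coded as binary digits, so that a pattern of directions towards `t` apexes becomes
-- an index below `2 ^ t`.
arc : Fin 2 → Mark 1 0
arc zero       = out zero
arc (suc zero) = inc zero

direction : Mark 1 0 → Fin 2
direction (out _) = zero
direction _       = suc zero

arc-direction : (a : Mark 1 0) → present a ≡ true → arc (direction a) ≡ a
arc-direction (out zero) _ = refl
arc-direction (inc zero) _ = refl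

-- The end: apexes and pairs added to a given graph.

module Apexes {w : ℕ} (G₀ : SimpleGraph w) (t : ℕ) where

  Pair Vertex : Set
  Pair   = Fin (2 ^ t) × Fin 2
  Vertex = (Pair × Fin 2) ⊎ (Fin t ⊎ Fin w)

  ends : ℕ
  ends = ((2 ^ t) * 2) * 2

  -- The numbering follows the order of deletion: first the ends of the pairs, then the apexes, and
  -- `G₀` last.
  vertices : Fin (ends + (t + w)) ↔ Vertex
  vertices = ↔-trans +↔⊎ (↔-trans *↔× (*↔× ×-↔ ↔-refl) ⊎-↔ +↔⊎)

  digit : Fin (2 ^ t) → Fin t → Fin 2
  digit = finToFun {2} {t}

  partners : Pair × Fin 2 → Pair × Fin 2 → Mark 0 2
  partners (q , e) (q′ , e′) with ≡-dec Fin._≟_ Fin._≟_ q q′ | e Fin.≟ e′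
  ... | yes _ | no _ = edge (proj₂ q)
  ... | _     | _    = none

  partners-flip : ∀ x y → partners y x ≡ flip (partners x y)
  partners-flip (q , e) (q′ , e′)
    with ≡-dec Fin._≟_ Fin._≟_ q q′ | ≡-dec Fin._≟_ Fin._≟_ q′ q | e Fin.≟ e′ | e′ Fin.≟ e
  ... | yes refl | yes _ | yes _ | yes _ = refl
  ... | yes refl | yes _ | yes p | no ¬p = contradiction (≡.sym p) ¬p
  ... | yes refl | yes _ | no ¬p | yes p = contradiction (≡.sym p) ¬p
  ... | yes refl | yes _ | no _  | no _  = refl
  ... | yes p    | no ¬p | _ | _ = contradiction (≡.sym p) ¬p
  ... | no ¬p    | yes p | _ | _ = contradiction (≡.sym p) ¬p
  ... | no _     | no _  | _ | _ = refl

  partners-loop : ∀ x → partners x x ≡ none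
  partners-loop (q , e) with ≡-dec Fin._≟_ Fin._≟_ q q | e Fin.≟ e
  ... | yes _ | yes _ = refl
  ... | yes _ | no ¬p = contradiction refl ¬p
  ... | no _  | _     = refl

  partners-present : ∀ q e q′ e′ → present (partners (q , e) (q′ , e′)) ≡ true → q ≡ q′ × e ≢ e′
  partners-present q e q′ e′ pr with ≡-dec Fin._≟_ Fin._≟_ q q′ | e Fin.≟ e′
  ... | yes q≡q′ | no e≢e′ = q≡q′ , e≢e′

  partners-edge : ∀ q {e e′} → e ≢ e′ → partners (q , e) (q , e′) ≡ edge (proj₂ q)
  partners-edge q {e} {e′} e≢e′ with ≡-dec Fin._≟_ Fin._≟_ q q | e Fin.≟ e′
  ... | yes _ | no _  = refl
  ... | yes _ | yes p = contradiction p e≢e′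
  ... | no ¬p | _     = contradiction refl ¬p

  apexes : Fin t → Fin t → Mark 0 2
  apexes l l′ with l Fin.≟ l′
  ... | yes _ = none
  ... | no _  = edge zero

  apexes-flip : ∀ l l′ → apexes l′ l ≡ flip (apexes l l′)
  apexes-flip l l′ with l Fin.≟ l′ | l′ Fin.≟ l
  ... | yes _ | yes _ = refl
  ... | yes p | no ¬p = contradiction (≡.sym p) ¬p
  ... | no ¬p | yes p = contradiction (≡.sym p) ¬p
  ... | no _  | no _  = refl

  apexes-present : ∀ {l l′} → l ≢ l′ → present (apexes l l′) ≡ true
  apexes-present {l} {l′} l≢l′ with l Fin.≟ l′
  ... | yes p = contradiction p l≢l′
  ... | no _  = refl

  old : Fin w → Fin w → Mark 0 2
  old x y = if adj G₀ x y then edge zero else none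

  present-old : ∀ x y → present (old x y) ≡ adj G₀ x y
  present-old x y with adj G₀ x y
  ... | true  = refl
  ... | false = refl

  mk₀ : Vertex → Vertex → Mark 0 2
  mk₀ (inj₁ x) (inj₁ y)                      = partners x y
  mk₀ (inj₁ ((σ , _) , _)) (inj₂ (inj₁ l))   = edge (digit σ l)
  mk₀ (inj₂ (inj₁ l)) (inj₁ ((σ , _) , _))   = edge (digit σ l)
  mk₀ (inj₂ (inj₁ l)) (inj₂ (inj₁ l′))       = apexes l l′
  mk₀ (inj₂ (inj₂ x)) (inj₂ (inj₂ y))        = old x y
  mk₀ _ _                                    = none

  flip₀ : ∀ a b → mk₀ b a ≡ flip (mk₀ a b)
  flip₀ (inj₁ x) (inj₁ y)                = partners-flip x y
  flip₀ (inj₁ _) (inj₂ (inj₁ _))         = refl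
  flip₀ (inj₁ _) (inj₂ (inj₂ _))         = refl
  flip₀ (inj₂ (inj₁ _)) (inj₁ _)         = refl
  flip₀ (inj₂ (inj₂ _)) (inj₁ _)         = refl
  flip₀ (inj₂ (inj₁ l)) (inj₂ (inj₁ l′)) = apexes-flip l l′
  flip₀ (inj₂ (inj₁ _)) (inj₂ (inj₂ _))  = refl
  flip₀ (inj₂ (inj₂ _)) (inj₂ (inj₁ _))  = refl
  flip₀ (inj₂ (inj₂ x)) (inj₂ (inj₂ y))  = ≡.trans
    (cong (λ b → if b then edge zero else none) (SimpleGraph.sym G₀ y x))
    (≡.sym (flip-edge (old x y)))

  loop₀ : ∀ a → mk₀ a a ≡ none
  loop₀ (inj₁ x) = partners-loop x
  loop₀ (inj₂ (inj₁ l)) with l Fin.≟ l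
  ... | yes _ = refl
  ... | no ¬p = contradiction refl ¬p
  loop₀ (inj₂ (inj₂ x)) = cong (λ b → if b then edge zero else none) (irrefl G₀ x)

  -- The pair (σ , b) is an edge of colour b that sees the apexes in the colours given by the
  -- binary digits of σ; edges with different σ cannot share colours.
  marking : Marking 0 2 Vertex
  marking = record { mk = mk₀ ; mk-flip = flip₀ ; mk-loop = loop₀ }

  G : SimpleGraph (ends + (t + w))
  G = graph vertices marking

  _~_ : Vertex → Vertex → Bool
  a ~ b = present (mk₀ a b)

  -- The neighbours of an end are its partner and all apexes, and these are pairwise adjacent.
  end-simplicial : ∀ x → Simplicial _~_ (inj₁ x)
  end-simplicial (q , e) (inj₁ (q₁ , e₁)) (inj₁ (q₂ , e₂)) y≢z x~y x~z
    with partners-present q e q₁ e₁ x~y | partners-present q e q₂ e₂ x~z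
  ... | refl , e≢e₁ | refl , e≢e₂ =
    contradiction (cong (λ e → inj₁ (q , e)) (≢-≢⇒≡ (e≢e₁ ∘ ≡.sym) e≢e₂)) y≢z
  end-simplicial x (inj₁ _) (inj₂ (inj₁ _)) _ _ _ = refl
  end-simplicial x (inj₂ (inj₁ _)) (inj₁ _) _ _ _ = refl
  end-simplicial x (inj₂ (inj₁ l)) (inj₂ (inj₁ l′)) y≢z _ _ = apexes-present λ { refl → y≢z refl }
  end-simplicial x (inj₁ _) (inj₂ (inj₂ _)) _ _ ()
  end-simplicial x (inj₂ (inj₁ _)) (inj₂ (inj₂ _)) _ _ ()

  -- Once the ends are gone, an apex is adjacent to other apexes only.
  apex-simplicial : ∀ l → Simplicial (λ a b → inj₂ a ~ inj₂ b) (inj₁ l)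
  apex-simplicial l (inj₁ l₁) (inj₁ l₂) y≢z _ _ = apexes-present λ { refl → y≢z refl }
  apex-simplicial l (inj₁ _) (inj₂ _) _ _ ()

  ends-simplicial : ∀ x → Simplicial (adj G) (x ↑ˡ (t + w))
  ends-simplicial x = simplicial-pull (to vertices) (to-injective vertices) (λ _ _ → refl)
    (subst (Simplicial _~_) (≡.sym (to-end x)) (end-simplicial _))
    where
    to-end : ∀ x → to vertices (x ↑ˡ (t + w)) ≡ inj₁ _
    to-end x rewrite Fin.splitAt-↑ˡ ends x (t + w) = refl

  to-rest : ∀ x → to vertices (ends ↑ʳ x) ≡ inj₂ (splitAt t x)
  to-rest x rewrite Fin.splitAt-↑ʳ ends (t + w) x = refl

  apexes-simplicial : ∀ l → Simplicial (adj (drop ends G)) (l ↑ˡ w)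
  apexes-simplicial l = simplicial-pull (splitAt t) (to-injective (+↔⊎ {t} {w}))
    (λ x y → cong₂ _~_ (to-rest x) (to-rest y))
    (subst (Simplicial _) (≡.sym (Fin.splitAt-↑ˡ t l w)) (apex-simplicial l))

  drop-all : G₀ ≐ drop t (drop ends G)
  drop-all x y = ≡.sym (≡.trans (cong₂ _~_ (to-old x) (to-old y)) (present-old x y))
    where
    to-old : ∀ x → to vertices (ends ↑ʳ (t ↑ʳ x)) ≡ inj₂ (inj₂ x)
    to-old x = ≡.trans (to-rest (t ↑ʳ x)) (cong inj₂ (Fin.splitAt-↑ʳ t w x))

  -- Each of the `2 ^ t` patterns occupies three vertices of the target: both ends of its first edge
  -- and one further end of its second.
  demands : Demands 0 2 G (2 ^ t * 3)
  demands = demands-via vertices marking *↔× pick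
    where
    module _ {j} (H : MixedGraph 0 2 j) (g : Vertex → Fin j)
             (pres : Preserves marking (along id H) g) where

      end : Fin (2 ^ t) → Fin 2 × Fin 2 → Fin j
      end σ (b , e) = g (inj₁ ((σ , b) , e))

      pair-edge : ∀ σ b {e e′} → e ≢ e′ → mark H (end σ (b , e)) (end σ (b , e′)) ≡ edge b
      pair-edge σ b e≢e′ = ≡.trans (pres _ _ (cong present (partners-edge (σ , b) e≢e′)))
                                   (partners-edge (σ , b) e≢e′)

      -- Different patterns differ at some apex `l`. A shared target vertex would meet the image of
      -- that apex in two edge colours.
      classes-disjoint : ∀ {σ τ} x y → end σ x ≡ end τ y → σ ≡ τ
      classes-disjoint {σ} {τ} x y eq = decidable-stable (σ Fin.≟ τ) λ σ≢τ →
        let l , ne = digit-distinguishes {t} σ≢τ in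
        ne (edge-injective (≡.trans (≡.sym (pres _ (inj₂ (inj₁ l)) refl))
             (≡.trans (cong (λ c → mark H c (g (inj₂ (inj₁ l)))) eq)
                      (pres _ (inj₂ (inj₁ l)) refl))))
        where
        edge-injective : {a b : Fin 2} → edge {0} a ≡ edge b → a ≡ b
        edge-injective refl = refl

      Fresh : Fin (2 ^ t) → Fin 2 × Fin 2 → Set
      Fresh σ u = ∀ e → end σ (zero , e) ≢ end σ u

      -- If both ends of the second edge had colours of the first, the two edges would coincide
      -- in the target in spite of their different colours.
      fresh-end : ∀ σ → ∃ (Fresh σ)
      fresh-end σ with reused? zero | reused? (suc zero)
        where
        reused? : ∀ d → Dec (∃ λ e → end σ (zero , e) ≡ end σ (suc zero , d))
        reused? d = Fin.any? λ e → end σ (zero , e) Fin.≟ end σ (suc zero , d)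
      ... | no ¬r | _     = _ , λ e eq → ¬r (e , eq)
      ... | yes _ | no ¬r = _ , λ e eq → ¬r (e , eq)
      ... | yes (e , p) | yes (e′ , p′) with e Fin.≟ e′
      ... | yes refl = contradiction (≡.trans (≡.sym p) p′)
            (adjacent-distinct H (pair-edge σ (suc zero) λ ()) refl)
      ... | no e≢e′  = contradiction
            (≡.trans (≡.sym (pair-edge σ zero e≢e′))
              (≡.trans (cong₂ (mark H) p p′) (pair-edge σ (suc zero) λ ())))
            λ ()

      chosen : Fin (2 ^ t) → Fin 3 → Fin 2 × Fin 2
      chosen σ zero             = zero , zero
      chosen σ (suc zero)       = zero , suc zero
      chosen σ (suc (suc zero)) = proj₁ (fresh-end σ)

      chosen-injective : ∀ σ c d → end σ (chosen σ c) ≡ end σ (chosen σ d) → c ≡ d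
      chosen-injective σ zero             zero             eq = refl
      chosen-injective σ (suc zero)       (suc zero)       eq = refl
      chosen-injective σ (suc (suc zero)) (suc (suc zero)) eq = refl
      chosen-injective σ zero             (suc zero)       eq =
        contradiction eq (adjacent-distinct H (pair-edge σ zero λ ()) refl)
      chosen-injective σ (suc zero)       zero             eq =
        contradiction eq (adjacent-distinct H (pair-edge σ zero λ ()) refl)
      chosen-injective σ zero             (suc (suc zero)) eq =
        contradiction eq (proj₂ (fresh-end σ) zero)
      chosen-injective σ (suc zero)       (suc (suc zero)) eq =
        contradiction eq (proj₂ (fresh-end σ) (suc zero))
      chosen-injective σ (suc (suc zero)) zero             eq =
        contradiction (≡.sym eq) (proj₂ (fresh-end σ) zero)
      chosen-injective σ (suc (suc zero)) (suc zero)       eq =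
        contradiction (≡.sym eq) (proj₂ (fresh-end σ) (suc zero))

      pick : Σ (Fin (2 ^ t) × Fin 3 → Fin j) (Injective _≡_ _≡_)
      pick = (λ { (σ , c) → end σ (chosen σ c) }) , injective
        where
        injective : Injective _≡_ _≡_ (λ { (σ , c) → end σ (chosen σ c) })
        injective {σ , c} {τ , d} eq with classes-disjoint {σ} {τ} (chosen σ c) (chosen τ d) eq
        ... | refl = cong (σ ,_) (chosen-injective σ c d eq)

  Colour : Set
  Colour = (Fin (2 ^ t) × Fin 2) ⊎ (Fin t ⊎ Fin w)

  colours : Fin (2 ^ t * 2 + (t + w)) ↔ Colour
  colours = ↔-trans +↔⊎ (*↔× ⊎-↔ +↔⊎)

  -- An arc inside a pair always leads from a tail to a head, so tails and heads with the same
  -- directions towards the apexes can share their colours.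
  bounded : Bounded 1 0 G (2 ^ t * 2 + (t + w))
  bounded = bounded-via vertices marking colours colouring
    where
    ordered : Fin 2 → Fin 2 → Mark 1 0
    ordered zero       (suc zero) = out zero
    ordered (suc zero) zero       = inc zero
    ordered _          _          = none

    ordered-flip : ∀ d e → ordered e d ≡ flip (ordered d e)
    ordered-flip zero       zero       = refl
    ordered-flip zero       (suc zero) = refl
    ordered-flip (suc zero) zero       = refl
    ordered-flip (suc zero) (suc zero) = refl

    ordered-loop : ∀ d → ordered d d ≡ none
    ordered-loop zero       = refl
    ordered-loop (suc zero) = refl

    ordered-direction : (a : Mark 1 0) → present a ≡ true →
                        ordered (direction a) (direction (flip a)) ≡ a
    ordered-direction (out zero) _ = refl
    ordered-direction (inc zero) _ = refl

    ≢⇒opposite : ∀ (d e : Fin 2) → d ≢ e → e ≡ opposite d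
    ≢⇒opposite = from-yes (Fin.all? λ (d : Fin 2) → Fin.all? λ e →
      ¬? (d Fin.≟ e) →-dec (e Fin.≟ opposite d))

    colouring : (M : Marking 1 0 Vertex) →
      (∀ a b → present (mk₀ a b) ≡ present (mk M a b)) →
      Σ (Marking 1 0 Colour) λ H → Σ (Vertex → Colour) (Preserves M H)
    colouring M u = record { mk = H ; mk-flip = H-flip ; mk-loop = H-loop } , f , pres
      where
      H : Colour → Colour → Mark 1 0
      -- The two ends of a pair may have different types, so every tail colour has an arc to every
      -- head colour.
      H (inj₁ (_ , d))  (inj₁ (_ , e))  = ordered d e
      H (inj₁ (σ , _))  (inj₂ (inj₁ l)) = arc (digit σ l)
      H (inj₁ _)        (inj₂ (inj₂ _)) = none
      H (inj₂ (inj₁ l)) (inj₁ (σ , _))  = flip (arc (digit σ l))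
      H (inj₂ (inj₂ _)) (inj₁ _)        = none
      H (inj₂ a)        (inj₂ b)        = mk M (inj₂ a) (inj₂ b)

      H-flip : ∀ a b → H b a ≡ flip (H a b)
      H-flip (inj₁ (_ , d))  (inj₁ (_ , e))   = ordered-flip d e
      H-flip (inj₁ _)        (inj₂ (inj₁ _))  = refl
      H-flip (inj₁ _)        (inj₂ (inj₂ _))  = refl
      H-flip (inj₂ (inj₁ l)) (inj₁ (σ , _))   = ≡.sym (flip-involutive (arc (digit σ l)))
      H-flip (inj₂ (inj₂ _)) (inj₁ _)         = refl
      H-flip (inj₂ (inj₁ l)) (inj₂ (inj₁ l′)) = mk-flip M _ _
      H-flip (inj₂ (inj₁ l)) (inj₂ (inj₂ y))  = mk-flip M _ _
      H-flip (inj₂ (inj₂ x)) (inj₂ (inj₁ l))  = mk-flip M _ _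
      H-flip (inj₂ (inj₂ x)) (inj₂ (inj₂ y))  = mk-flip M _ _

      H-loop : ∀ a → H a a ≡ none
      H-loop (inj₁ (_ , d))   = ordered-loop d
      H-loop (inj₂ (inj₁ l))  = mk-loop M _
      H-loop (inj₂ (inj₂ x))  = mk-loop M _

      partner : Pair × Fin 2 → Pair × Fin 2
      partner (q , e) = q , opposite e

      side : Pair × Fin 2 → Fin 2
      side x = direction (mk M (inj₁ x) (inj₁ (partner x)))

      -- The pattern is read off from `M` and may differ from the index of the pair.
      type : Pair × Fin 2 → Fin (2 ^ t)
      type x = funToFin λ l → direction (mk M (inj₁ x) (inj₂ (inj₁ l)))

      f : Vertex → Colour
      f (inj₁ x) = inj₁ (type x , side x)
      f (inj₂ a) = inj₂ a

      pres-apex : ∀ x l → arc (digit (type x) l) ≡ mk M (inj₁ x) (inj₂ (inj₁ l))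
      pres-apex x l = ≡.trans (cong arc (Fin.finToFun-funToFin _ l))
        (arc-direction (mk M (inj₁ x) (inj₂ (inj₁ l))) (≡.sym (u (inj₁ x) (inj₂ (inj₁ l)))))

      pres-pair : ∀ x y → present (mk M (inj₁ x) (inj₁ y)) ≡ true →
                  ordered (side x) (side y) ≡ mk M (inj₁ x) (inj₁ y)
      pres-pair x@(q , e) y@(q′ , e′) pr
        with partners-present q e q′ e′ (≡.trans (u (inj₁ x) (inj₁ y)) pr)
      ... | refl , e≢e′ with ≢⇒opposite e e′ e≢e′
      -- As `y` is the partner of `x`, `side y` reads the same arc from its other end.
      ... | refl = ≡.trans
        (cong (ordered (side x)) (cong direction (≡.trans
          (cong (λ d → mk M (inj₁ y) (inj₁ (q , d))) (Fin.opposite-involutive e))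
          (mk-flip M (inj₁ x) (inj₁ y)))))
        (ordered-direction (mk M (inj₁ x) (inj₁ y)) pr)

      pres : ∀ a b → present (mk M a b) ≡ true → H (f a) (f b) ≡ mk M a b
      pres (inj₁ x) (inj₁ y) pr                = pres-pair x y pr
      pres (inj₁ x) (inj₂ (inj₁ l)) pr         = pres-apex x l
      pres (inj₁ x) (inj₂ (inj₂ z)) pr         =
        contradiction (≡.trans (u (inj₁ x) (inj₂ (inj₂ z))) pr) λ ()
      pres (inj₂ (inj₁ l)) (inj₁ x) pr         = ≡.trans (cong flip (pres-apex x l))
                                                         (≡.sym (mk-flip M _ _))
      pres (inj₂ (inj₂ z)) (inj₁ x) pr         =
        contradiction (≡.trans (u (inj₂ (inj₂ z)) (inj₁ x)) pr) λ ()
      pres (inj₂ (inj₁ l)) (inj₂ b) pr  = refl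
      pres (inj₂ (inj₂ z)) (inj₂ b) pr  = refl

-- Numerical estimates and choice of parameters.

suc≤2^ : ∀ n → suc n ≤ 2 ^ n
suc≤2^ zero    = ℕ.≤-refl
suc≤2^ (suc n) = begin
  suc (suc n)         ≤⟨ s≤s (s≤s (ℕ.m≤n+m n n)) ⟩
  suc (suc (n + n))   ≡⟨ cong suc (ℕ.+-suc n n) ⟨
  suc n + suc n       ≤⟨ ℕ.+-mono-≤ (suc≤2^ n) (suc≤2^ n) ⟩
  2 ^ n + 2 ^ n       ≡⟨ cong (_+_ (2 ^ n)) (ℕ.+-identityʳ (2 ^ n)) ⟨
  2 ^ suc n           ∎
  where open ℕ.≤-Reasoning

-- With `k = 4 + q`, folding saves `n` colours, while the hub colours and the shift by `q` cost
-- `10 + 3 * q`, which is below `16 * suc q`.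
pentagons-suffice : ∀ {n} p q → 16 * suc q ≤ n → n * 4 + (2 + (4 + q) * 2) + q ≤ n * 5 + p
pentagons-suffice {n} p q q≤n = begin
  n * 4 + (2 + (4 + q) * 2) + q                ≡⟨ rearrange n q ⟩
  n * 4 + (10 + 3 * q)                         ≤⟨ ℕ.m≤m+n _ (6 + 13 * q) ⟩
  n * 4 + (10 + 3 * q) + (6 + 13 * q)          ≡⟨ collect n q ⟩
  n * 4 + 16 * suc q                           ≤⟨ ℕ.+-monoʳ-≤ (n * 4) q≤n ⟩
  n * 4 + n                                    ≡⟨ ℕ.+-comm (n * 4) n ⟩
  n + n * 4                                    ≡⟨ ℕ.*-suc n 4 ⟨
  n * 5                                        ≤⟨ ℕ.m≤m+n _ p ⟩
  n * 5 + p                                    ∎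
  where
  open ℕ.≤-Reasoning
  rearrange : ∀ n q → n * 4 + (2 + (4 + q) * 2) + q ≡ n * 4 + (10 + 3 * q)
  rearrange = solve-∀
  collect : ∀ n q → n * 4 + (10 + 3 * q) + (6 + 13 * q) ≡ n * 4 + 16 * suc q
  collect = solve-∀

apexes-suffice : ∀ {n} t w p q → t + (w + p) ≤ n → n * 2 + (t + w) + p ≤ n * 3 + q
apexes-suffice {n} t w p q le = begin
  n * 2 + (t + w) + p   ≡⟨ rearrange n t w p ⟩
  n * 2 + (t + (w + p)) ≤⟨ ℕ.+-monoʳ-≤ (n * 2) le ⟩
  n * 2 + n             ≡⟨ ℕ.+-comm (n * 2) n ⟩
  n + n * 2             ≡⟨ ℕ.*-suc n 2 ⟨
  n * 3                 ≤⟨ ℕ.m≤m+n _ q ⟩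
  n * 3 + q             ∎
  where
  open ℕ.≤-Reasoning
  rearrange : ∀ n t w p → n * 2 + (t + w) + p ≡ n * 2 + (t + (w + p))
  rearrange = solve-∀

module _ (p q k t : ℕ) where

  open Interpolation p q
  module P = Pentagons k
  module E = Apexes P.G t

  -- Deletion either meets the target on the way or ends at the pentagon graph, where `Above` and
  -- `Below` hold together.
  realise-by : P.N * 4 + (2 + k * 2) + q ≤ P.N * 5 + p →
               2 ^ t * 2 + (t + P.v₀) + p ≤ 2 ^ t * 3 + q → Realises (p ⊖ q)
  realise-by low high
    with descend-many E.ends E.G E.ends-simplicial (above-if E.G E.demands E.bounded high)
  ... | inj₁ r     = r
  ... | inj₂ above with descend-many t (drop E.ends E.G) E.apexes-simplicial above
  ... | inj₁ r      = r
  ... | inj₂ above′ = meet G above′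
    (below-if G (bounded-cong {G = P.G} {G} E.drop-all P.bounded)
                (demands-cong {G = P.G} {G} E.drop-all P.demands) low)
    where
    G : SimpleGraph P.v₀
    G = drop t (drop E.ends E.G)

realise-⊖ : ∀ p q → Realises (p ⊖ q)
-- The exponent `4 + q` gives `16 * 2 ^ q` pentagons, at least `16 * suc q`.
realise-⊖ p q = realise-by p q (4 + q) (suc s)
  (pentagons-suffice {2 ^ (4 + q)} p q
    (ℕ.≤-trans (ℕ.*-monoʳ-≤ 16 (suc≤2^ q)) (ℕ.≤-reflexive (≡.sym (ℕ.^-distribˡ-+-* 2 4 q)))))
  (apexes-suffice {2 ^ suc s} (suc s) _ p q
    (ℕ.+-mono-≤ (suc≤2^ s) (ℕ.≤-trans (ℕ.<⇒≤ (suc≤2^ s)) (ℕ.m≤m+n (2 ^ s) 0))))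
  where
  s : ℕ
  -- With `t = suc s`, the need `t + (w + p)` equals `suc s + s`, at most twice `2 ^ s`.
  s = Pentagons.v₀ (4 + q) + p

theorem5 : (z : ℤ) → ∃[ v ] Σ (SimpleGraph v) λ G → ∃[ a ] ∃[ b ]
    (IsChi 0 2 G a × IsChi 1 0 G b × (+ a - + b ≡ z))
-- Every integer is `p ⊖ 0` or `0 ⊖ suc q` by computation.
theorem5 (+ p)    = realise-⊖ p 0
theorem5 -[1+ q ] = realise-⊖ 0 (suc q)
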